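{- Let $k$ be a positive integer, let $G$ be a connected graph, let $a_1, \dotsc, a_n$ be an ordering of the vertices of $G$, and let $\widetilde{G}$ be the graph constructed from $k$, $G$ and this ordering as described in the context. Suppose that $\widetilde{G}$ has a tree decomposition $(T, \mathcal{B})$ of width at most $k$ such that $T$ is a spanning tree of $\widetilde{G}$. Then there exists a tree decomposition $(T', \mathcal{B}')$ of $G$ of width at most $k+1$ such that $T'$ is a spanning tree of $G$ and for every $v \in V(G)$, we have $v \in V(T'_v)$ (equivalently, $v \in B'_v$ for every $v \in V(G) = V(T')$).
   Context: Graphs are finite and simple. Tree decompositions. Let $H$ be a graph, $T$ a tree, and $\mathcal{B} = \{B_x : x \in V(T)\}$ a family of subsets of $V(H)$ indexed by the vertices of $T$. For $v \in V(H)$ let $T_v := T[\{x \in V(T) : v \in B_x\}]$. Then $(T,\mathcal{B})$ is a tree decomposition of $H$ if (i) each $T_v$ is a non-empty subtree (connected acyclic subgraph) of $T$, and (ii) for every $uv \in E(H)$, $V(T_u) \cap V(T_v) \neq \emptyset$. Its width is $\max_{x \in V(T)} |B_x| - 1$. When $T$ is a spanning tree of $H$, the vertices of $T$ (indexing the bags) are the vertices of $H$ themselves, so the condition $v \in V(T_v)$ makes sense. For $(T',\mathcal{B}')$ with $\mathcal{B}' = \{B'_x : x \in V(T')\}$, the subtree $T'_v$ is defined analogously as $T'[\{x \in V(T') : v \in B'_x\}]$. Construction of $\widetilde{G}$. Fix a positive integer $k$, a graph $G$, and an ordering $a_1, \dotsc, a_n$ of $V(G)$ (so $n = |V(G)|$).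 Define integers $h_1 := 2$ and $h_j := (k+2)^{2h_{j-1}} + 1$ for $2 \le j \le n$. Define integers $w_n, w_{n-1}, \dotsc, w_1$ and rooted trees $S_n, S_{n-1}, \dotsc, S_1$ recursively, in decreasing order of index: $w_n := (k+1)n + 1$; given $w_j$, $S_j$ is the complete rooted $w_j$-ary tree of height $h_j$ (every vertex at distance less than $h_j$ from the root has exactly $w_j$ children, and the leaves are exactly the vertices at distance $h_j$ from the root); and given $S_n, \dotsc, S_{j+1}$, $$w_j := (k+1)\Bigl(n + \sum_{i=j+1}^n |V(S_i)|\Bigr) + 1.$$ Finally, $\widetilde{G}$ is obtained from the disjoint union of $G, S_1, \dotsc, S_n$ by identifying, for each $j \in \{1,\dotsc,n\}$, the vertex $a_j$ with the root of $S_j$. -}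

module Defs where

open import Algebra.Properties.CommutativeMonoid.Sum using (sum)
open import Data.Empty using (⊥-elim)
open import Data.Fin.Base using (Fin; zero; suc; toℕ)
import Data.Fin.Properties as Fin
import Data.Fin.Subset as Sub
open import Data.List.Base using (List; []; _∷_; _∷ʳ_; length; map; tabulate)
open import Data.List.Extrema.Nat using (max)
open import Data.List.Relation.Unary.Linked using (Linked)
open import Data.List.Relation.Unary.Unique.Propositional using (Unique)
open import Data.Nat.Base using (ℕ; zero; suc; _+_; _*_; _∸_; _^_; _≤_)
open import Data.Nat.Properties using (+-0-commutativeMonoid)
open import Data.Product.Base using (Σ; ∃; _×_; _,_; proj₁; proj₂)
open import Data.Product.Function.NonDependent.Propositional using (_×-↔_)
open import Data.Sum.Base using (_⊎_; inj₁; inj₂)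
open import Data.Sum.Function.Propositional using (_⊎-↔_)
open import Data.Unit.Base using (⊤; tt)
open import Function.Base using (_∘_; _on_)
open import Function.Bundles using (_↔_; Inverse; mk↔ₛ′)
open import Function.Construct.Composition using (_↔-∘_)
open import Function.Construct.Identity using (↔-id)
open import Function.Construct.Symmetry using (↔-sym)
open import Level using (0ℓ)
open import Relation.Binary.Core using (Rel; _⇒_)
open import Relation.Binary.Definitions using (Decidable; Irreflexive; Symmetric)
open import Relation.Binary.Construct.Closure.ReflexiveTransitive using (Star)
open import Relation.Binary.Construct.Closure.Symmetric using (SymClosure; fwd; bwd; symmetric)
open import Relation.Binary.PropositionalEquality using (_≡_; refl; cong)
open import Relation.Nullary using (¬_; Dec; yes; no)
open import Relation.Nullary.Decidable using (map′; _⊎-dec_)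
open import Relation.Unary using (Pred; Satisfiable; _∩_)

record Finite (A : Set) : Set where
  field
    size        : ℕ
    enumeration : A ↔ Fin size

card : (A : Set) → {{Finite A}} → ℕ
card A {{F}} = Finite.size F

index : {A : Set} {{_ : Finite A}} → A → Fin (card A)
index {{F}} = Inverse.to (Finite.enumeration F)

elements : (A : Set) {{_ : Finite A}} → List A
elements A {{F}} = tabulate (Inverse.from (Finite.enumeration F))

Subset : (A : Set) → {{Finite A}} → Set
Subset A = Sub.Subset (card A)

infix 4 _∈_

_∈_ : {A : Set} {{_ : Finite A}} → A → Subset A → Set
x ∈ p = index x Sub.∈ p

-- Simple graphs with vertex set V; finiteness is the separate instance
-- Finite V.  For finite graphs, decidability of adjacency is no restriction
-- classically.
record Graph (V : Set) : Set₁ where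
  field
    Adj    : Rel V 0ℓ
    adj?   : Decidable Adj
    sym    : Symmetric Adj
    irrefl : Irreflexive _≡_ Adj

open Graph public using (Adj)

-- The null graph is not connected.
Connected : {V : Set} → Graph V → Set
Connected {V} G = V × (∀ u v → Star (Adj G) u v)

-- The closed walk v, vs, v is a cycle (of length 1 + length vs).
IsCycle : {V : Set} → Graph V → V → List V → Set
IsCycle G v vs = 2 ≤ length vs × Unique (v ∷ vs) × Linked (Adj G) (v ∷ (vs ∷ʳ v))

Acyclic : {V : Set} → Graph V → Set
Acyclic G = ∀ v vs → ¬ IsCycle G v vs

IsTree : {V : Set} → Graph V → Set
IsTree G = Connected G × Acyclic G

-- "Spanning" is expressed by T and H sharing their vertex type.
IsSpanningTree : {V : Set} → Graph V → Graph V → Set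
IsSpanningTree T H = IsTree T × Adj T ⇒ Adj H

-- The subgraph of G induced by P.  It is only used for propositional P, so
-- that the elements of ∃ P are exactly the vertices satisfying P.
induced : {V : Set} → Graph V → (P : Pred V 0ℓ) → Graph (∃ P)
induced G P = record
  { Adj    = Adj G on proj₁
  ; adj?   = λ x y → Graph.adj? G (proj₁ x) (proj₁ y)
  ; sym    = Graph.sym G
  ; irrefl = λ x≡y → Graph.irrefl G (cong proj₁ x≡y)
  }

-- The vertex set of the subtree T_v.
BagsAt : {X V : Set} {{_ : Finite V}} → (X → Subset V) → V → Pred X 0ℓ
BagsAt B v x = v ∈ B x

subtree : {X V : Set} {{_ : Finite V}} → Graph X → (B : X → Subset V) →
          (v : V) → Graph (∃ (BagsAt B v))
subtree T B v = induced T (BagsAt B v)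

record TreeDecomposition {X V : Set} {{_ : Finite X}} {{_ : Finite V}}
         (H : Graph V) (T : Graph X) : Set where
  field
    bag      : X → Subset V
    tree     : IsTree T
    subtrees : (v : V) → IsTree (subtree T bag v)
    edges    : {u v : V} → Adj H u v → Satisfiable (BagsAt bag u ∩ BagsAt bag v)

open TreeDecomposition public using (bag)

-- Truncated subtraction only matters when all bags are empty, which in a tree
-- decomposition happens only for the null graph.
width : {X V : Set} {{_ : Finite X}} {{_ : Finite V}} {H : Graph V} {T : Graph X} →
        TreeDecomposition H T → ℕ
width {X} D = max 0 (map (λ x → Sub.∣ bag D x ∣) (elements X)) ∸ 1

-- The vertices of the complete rooted w-ary tree of height h, as paths
-- descending from the root.
data Node (w : ℕ) : ℕ → Set where
  root  : ∀ {h} → Node w h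
  child : ∀ {h} → Fin w → Node w h → Node w (suc h)

data ParentOf {w : ℕ} : {h : ℕ} → Rel (Node w h) 0ℓ where
  here  : ∀ {h i} → ParentOf {h = suc h} root (child i root)
  there : ∀ {h i} {x y : Node w h} → ParentOf x y → ParentOf (child i x) (child i y)

node↔ : ∀ {w h} → Node w (suc h) ↔ (⊤ ⊎ (Fin w × Node w h))
node↔ = mk↔ₛ′
  (λ { root → inj₁ tt ; (child i x) → inj₂ (i , x) })
  (λ { (inj₁ _) → root ; (inj₂ (i , x)) → child i x })
  (λ { (inj₁ _) → refl ; (inj₂ _) → refl })
  (λ { root → refl ; (child _ _) → refl })

finite-Node : (w h : ℕ) → Finite (Node w h)
finite-Node w zero = record
  { size        = 1
  ; enumeration = mk↔ₛ′ (λ _ → zero) (λ _ → root) (λ { zero → refl }) (λ { root → refl })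
  }
finite-Node w (suc h) = record
  { size        = 1 + w * Finite.size F
  ; enumeration =
      ↔-sym Fin.+↔⊎ ↔-∘ ((↔-sym Fin.1↔⊤ ⊎-↔ (↔-sym Fin.*↔× ↔-∘ (↔-id _ ×-↔ Finite.enumeration F))) ↔-∘ node↔)
  }
  where F = finite-Node w h

instance
  Node-finite : ∀ {w h} → Finite (Node w h)
  Node-finite = finite-Node _ _

root? : ∀ {w h} (x : Node w h) → Dec (x ≡ root)
root? root        = yes refl
root? (child _ _) = no λ ()

parentOf? : ∀ {w h} → Decidable (ParentOf {w} {h})
parentOf? root        root                  = no λ ()
parentOf? root        (child i root)        = yes here
parentOf? root        (child i (child _ _)) = no λ ()
parentOf? (child i x) root                  = no λ ()
parentOf? (child i x) (child j y) with i Fin.≟ j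
... | no i≢j   = no λ { (there _) → i≢j refl }
... | yes refl = map′ there (λ { (there p) → p }) (parentOf? x y)

parentOf-irrefl : ∀ {w h} {x : Node w h} → ¬ ParentOf x x
parentOf-irrefl (there p) = parentOf-irrefl p

completeTree : (w h : ℕ) → Graph (Node w h)
completeTree w h = record
  { Adj    = SymClosure ParentOf
  ; adj?   = λ x y → map′ (λ { (inj₁ p) → fwd p ; (inj₂ p) → bwd p })
                          (λ { (fwd p) → inj₁ p ; (bwd p) → inj₂ p })
                          (parentOf? x y ⊎-dec parentOf? y x)
  ; sym    = symmetric ParentOf
  ; irrefl = λ { refl (fwd p) → parentOf-irrefl p ; refl (bwd p) → parentOf-irrefl p }
  }

-- Indices start at 0: heights k j is h_{j+1}, and similarly below j : Fin n
-- stands for the index j + 1.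
heights : ℕ → ℕ → ℕ
heights k zero    = 2
heights k (suc j) = (k + 2) ^ (2 * heights k j) + 1

-- The branching numbers of the last m trees, given the heights of these trees;
-- n is the total number of trees.  Since w_j depends only on the trees of
-- larger index, the recursion drops the first of the m trees.  The value of w_n
-- is the case of the empty sum.
arities : (k n : ℕ) {m : ℕ} → (Fin m → ℕ) → Fin m → ℕ
arities k n {suc m} h zero =
  (k + 1) * (n + sum +-0-commutativeMonoid
                   (λ i → card (Node (arities k n (h ∘ suc) i) (h (suc i))))) + 1
arities k n {suc m} h (suc j) = arities k n (h ∘ suc) j

height : (k : ℕ) {n : ℕ} → Fin n → ℕ
height k j = heights k (toℕ j)

arity : (k : ℕ) {n : ℕ} → Fin n → ℕ
arity k {n} = arities k n (height k)

S : (k : ℕ) {n : ℕ} (j : Fin n) → Graph (Node (arity k j) (height k j))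
S k j = completeTree (arity k j) (height k j)

-- The vertices of G̃.  As every vertex of G is a_j for exactly one j and is
-- identified with the root of S_j, each vertex of G̃ comes from exactly one
-- vertex of exactly one S_j, and (j , root) is a_j.
record V~ (k n : ℕ) : Set where
  constructor _,_
  field
    part : Fin n
    node : Node (arity k part) (height k part)

data Adj~ (k : ℕ) {V : Set} (G : Graph V) {n : ℕ} (a : Fin n ↔ V) : Rel (V~ k n) 0ℓ where
  inG : ∀ {i j} → Adj G (Inverse.to a i) (Inverse.to a j) → Adj~ k G a (i , root) (j , root)
  inS : ∀ {j x y} → Adj (S k j) x y → Adj~ k G a (j , x) (j , y)

Σ-finite : ∀ {n} (F : Fin n → Set) → (∀ i → Finite (F i)) → Finite (Σ (Fin n) F)
Σ-finite {zero} F fin = record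
  { size        = 0
  ; enumeration = mk↔ₛ′ (λ { (() , _) }) (λ ()) (λ ()) (λ { (() , _) })
  }
Σ-finite {suc n} F fin = record
  { size        = Finite.size (fin zero) + Finite.size rest
  ; enumeration =
      ↔-sym Fin.+↔⊎ ↔-∘ ((Finite.enumeration (fin zero) ⊎-↔ Finite.enumeration rest) ↔-∘ split)
  }
  where
  rest : Finite (Σ (Fin n) (F ∘ suc))
  rest = Σ-finite (F ∘ suc) (fin ∘ suc)

  split : Σ (Fin (suc n)) F ↔ (F zero ⊎ Σ (Fin n) (F ∘ suc))
  split = mk↔ₛ′
    (λ { (zero , x) → inj₁ x ; (suc i , x) → inj₂ (i , x) })
    (λ { (inj₁ x) → zero , x ; (inj₂ (i , x)) → suc i , x })
    (λ { (inj₁ _) → refl ; (inj₂ _) → refl })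
    (λ { (zero , _) → refl ; (suc _ , _) → refl })

finite-V~ : (k n : ℕ) → Finite (V~ k n)
finite-V~ k n = record
  { size        = Finite.size F
  ; enumeration = Finite.enumeration F ↔-∘
      mk↔ₛ′ (λ { (j , x) → j , x }) (λ { (j , x) → j , x }) (λ _ → refl) (λ _ → refl)
  }
  where F = Σ-finite {n} (λ j → Node (arity k j) (height k j)) (λ _ → finite-Node _ _)

instance
  V~-finite : ∀ {k n} → Finite (V~ k n)
  V~-finite = finite-V~ _ _

adj~? : (k : ℕ) {V : Set} (G : Graph V) {n : ℕ} (a : Fin n ↔ V) → Decidable (Adj~ k G a)
adj~? k G a (i , x) (j , y) with i Fin.≟ j
adj~? k G a (i , x) (.i , y) | yes refl =
  map′ inS
       (λ { (inG e) → ⊥-elim (Graph.irrefl G refl e) ; (inS e) → e })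
       (Graph.adj? (S k i) x y)
adj~? k G a (i , x) (j , y) | no i≢j with root? x | root? y
... | no x≢r   | _        = no λ { (inG _) → x≢r refl ; (inS _) → i≢j refl }
... | yes _    | no y≢r   = no λ { (inG _) → y≢r refl ; (inS _) → i≢j refl }
... | yes refl | yes refl =
  map′ inG
       (λ { (inG e) → e ; (inS _) → ⊥-elim (i≢j refl) })
       (Graph.adj? G (Inverse.to a i) (Inverse.to a j))

-- The graph G̃ for the ordering a of the vertices of G.
G~ : (k : ℕ) {V : Set} (G : Graph V) {n : ℕ} (a : Fin n ↔ V) → Graph (V~ k n)
G~ k G a = record
  { Adj    = Adj~ k G a
  ; adj?   = adj~? k G a
  ; sym    = λ { (inG e) → inG (Graph.sym G e) ; (inS {j} e) → inS (Graph.sym (S k j) e) }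
  ; irrefl = λ { refl (inG e) → Graph.irrefl G refl e
               ; refl (inS {j} e) → Graph.irrefl (S k j) refl e }
  }

{-# OPTIONS --safe #-}

-- Let S_j° be S_j without its root a_j, and T_v the subtree of bags containing v.
-- Every nonleaf of S_j has w_j children, more than the bags of T at V(G) and at
-- the S_i with i > j can hold, so one of the children lies in none of these bags.
-- Choosing such children successively gives a path p_1, ..., p_{h_j} descending from
-- the root a_j.  Consecutive T_{p_m} meet and none contains a root, so
-- all lie in one S_i°, with i ≤ j.  A path decomposed over a tree of height h with
-- bags of size at most k + 1 has fewer than (k+2)^(h+1) vertices, and h_j is too
-- large for i < j; hence i = j, and T_{a_j} meets S_j since it meets T_{p_1}.
-- Now let T' be T restricted to V(G), and B'_v = (B_v ∩ V(G)) ∪ {v}.  If v ∉ B_v then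
-- T_v stays inside the pendant tree at v, so T'_v = {v}, and T_u contains v
-- for every neighbour u of v.

module Submission where

open import Defs
open import Algebra.Properties.CommutativeMonoid.Sum using (sum)
open import Data.Fin.Base using (Fin; zero; suc; toℕ)
import Data.Fin.Properties as Fin
open import Data.Fin.Subset as Sub using (inside; outside; _∪_; _-_; ⋃; ⁅_⁆)
import Data.Fin.Subset.Properties as Sub
open import Data.List.Base using (List; []; _∷_; _∷ʳ_; _++_; length; map; filter; tabulate; allFin)
import Data.List.Extrema.Nat as Extrema
open import Data.List.Membership.Propositional using () renaming (_∈_ to _∈ᴸ_)
open import Data.List.Membership.Propositional.Properties
  using (∈-map⁺; ∈-++⁺ˡ; ∈-++⁺ʳ; ∈-tabulate⁺; ∈-allFin)
import Data.List.Properties as List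
open import Data.List.Relation.Unary.All as All using (All; []; _∷_)
import Data.List.Relation.Unary.All.Properties as All
open import Data.List.Relation.Unary.AllPairs using (AllPairs; []; _∷_)
open import Data.List.Relation.Unary.Any using (here; there)
open import Data.List.Relation.Unary.Linked as Linked using (Linked; []; [-]; _∷_)
import Data.List.Relation.Unary.Linked.Properties as Linked
open import Data.List.Relation.Unary.Unique.Propositional using (Unique)
import Data.List.Relation.Unary.Unique.Propositional.Properties as Unique
open import Data.Nat.Base
open import Data.Nat.Properties
open import Data.Product.Base using (Σ; Σ-syntax; ∃; _×_; _,_; proj₁; proj₂)
open import Data.Sum.Base using (_⊎_; inj₁; inj₂)
open import Data.Unit.Base using (⊤; tt)
import Data.Vec.Base as Vec
open import Data.Vec.Base using (_∷_; [])
open import Data.Vec.Properties using (lookup∘tabulate; lookup⇒[]=; []=⇒lookup)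
open import Data.Vec.Properties.WithK using ([]=-irrelevant)
open import Function.Base using (_∘_; _on_; id)
open import Function.Bundles using (_↔_; Inverse)
open import Function.Definitions using (Injective)
open import Level using (0ℓ)
open import Relation.Binary.Core using (Rel; _⇒_)
open import Relation.Binary.Construct.Closure.ReflexiveTransitive as Star using (Star; ε; _◅_)
open import Relation.Binary.Construct.Closure.Symmetric using (fwd; bwd)
open import Relation.Binary.PropositionalEquality
  using (_≡_; _≢_; refl; sym; trans; cong; cong₂; subst; subst₂)
open import Relation.Nullary using (¬_; Dec; yes; no; does; contradiction)
open import Relation.Nullary.Decidable using (dec-true)
open import Relation.Unary using (Pred; Decidable; Satisfiable; _∩_; ∁)

-- Cardinalities of finite subsets

∣p∪q∣≤∣p∣+∣q∣ : ∀ {n} (p q : Sub.Subset n) → Sub.∣ p ∪ q ∣ ≤ Sub.∣ p ∣ + Sub.∣ q ∣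
∣p∪q∣≤∣p∣+∣q∣ []            []            = z≤n
∣p∪q∣≤∣p∣+∣q∣ (outside ∷ p) (outside ∷ q) = ∣p∪q∣≤∣p∣+∣q∣ p q
∣p∪q∣≤∣p∣+∣q∣ (outside ∷ p) (inside ∷ q)  =
  ≤-trans (s≤s (∣p∪q∣≤∣p∣+∣q∣ p q)) (≤-reflexive (sym (+-suc Sub.∣ p ∣ Sub.∣ q ∣)))
∣p∪q∣≤∣p∣+∣q∣ (inside ∷ p)  (outside ∷ q) = s≤s (∣p∪q∣≤∣p∣+∣q∣ p q)
∣p∪q∣≤∣p∣+∣q∣ (inside ∷ p)  (inside ∷ q)  =
  s≤s (≤-trans (∣p∪q∣≤∣p∣+∣q∣ p q) (+-monoʳ-≤ Sub.∣ p ∣ (n≤1+n Sub.∣ q ∣)))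

∣⋃ps∣≤length*K : ∀ {n K} {ps : List (Sub.Subset n)} → All (λ p → Sub.∣ p ∣ ≤ K) ps →
                Sub.∣ ⋃ ps ∣ ≤ length ps * K
∣⋃ps∣≤length*K {n} [] = ≤-reflexive (Sub.∣⊥∣≡0 n)
∣⋃ps∣≤length*K {ps = p ∷ ps} (p≤K ∷ ps≤K) =
  ≤-trans (∣p∪q∣≤∣p∣+∣q∣ p (⋃ ps)) (+-mono-≤ p≤K (∣⋃ps∣≤length*K ps≤K))

p⊆⋃ps : ∀ {n} {p : Sub.Subset n} {ps} → p ∈ᴸ ps → p Sub.⊆ ⋃ ps
p⊆⋃ps (here refl)  = Sub.p⊆p∪q _
p⊆⋃ps (there p∈ps) = Sub.q⊆p∪q _ _ ∘ p⊆⋃ps p∈ps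

-- Deleting `f zero` from `q` pays for the element `zero` of `p`; injectivity keeps the other images
-- in what remains.
injective⇒∣p∣≤∣q∣ : ∀ {m n} (f : Fin m → Fin n) → Injective _≡_ _≡_ f →
                   (p : Sub.Subset m) (q : Sub.Subset n) →
                   (∀ {i} → i Sub.∈ p → f i Sub.∈ q) → Sub.∣ p ∣ ≤ Sub.∣ q ∣
injective⇒∣p∣≤∣q∣ f inj []            q p→q = z≤n
injective⇒∣p∣≤∣q∣ f inj (outside ∷ p) q p→q =
  injective⇒∣p∣≤∣q∣ (f ∘ suc) (Fin.suc-injective ∘ inj) p q (p→q ∘ Vec.there)
injective⇒∣p∣≤∣q∣ f inj (inside ∷ p)  q p→q =
  ≤-trans
    (s≤s (injective⇒∣p∣≤∣q∣ (f ∘ suc) (Fin.suc-injective ∘ inj) p (q - f zero)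
      (λ i∈p → Sub.x∈p∧x≢y⇒x∈p-y (p→q (Vec.there i∈p)) (λ eq → Fin.0≢1+n (sym (inj eq))))))
    (Sub.x∈p⇒∣p-x∣<∣p∣ (p→q Vec.here))

unique⇒length≤∣p∣ : ∀ {n} {p : Sub.Subset n} {xs} → Unique xs → All (Sub._∈ p) xs →
                   length xs ≤ Sub.∣ p ∣
unique⇒length≤∣p∣ []          []           = z≤n
unique⇒length≤∣p∣ (x∉xs ∷ xs!) (x∈p ∷ xs⊆p) =
  ≤-trans
    (s≤s (unique⇒length≤∣p∣ xs!
      (All.zipWith (λ { (x≢y , y∈p) → Sub.x∈p∧x≢y⇒x∈p-y y∈p (x≢y ∘ sym) }) (x∉xs , xs⊆p))))
    (Sub.x∈p⇒∣p-x∣<∣p∣ x∈p)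

index-injective : ∀ {A : Set} {{_ : Finite A}} → Injective _≡_ _≡_ (index {A})
index-injective {{F}} {x} {y} eq =
  trans (sym (E.strictlyInverseʳ x)) (trans (cong E.from eq) (E.strictlyInverseʳ y))
  where module E = Inverse (Finite.enumeration F)

∈-elements : ∀ {A : Set} {{_ : Finite A}} (x : A) → x ∈ᴸ elements A
∈-elements {{F}} x = subst (_∈ᴸ _) (E.strictlyInverseʳ x) (∈-tabulate⁺ (E.to x))
  where module E = Inverse (Finite.enumeration F)

-- Walks and cycles

acyclic-pullback : ∀ {A B : Set} (H : Graph A) (K : Graph B) (f : A → B) →
                   Injective _≡_ _≡_ f → (∀ {x y} → Adj H x y → Adj K (f x) (f y)) →
                   Acyclic K → Acyclic H
acyclic-pullback H K f inj hom acyclic v vs (long , unique , linked) =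
  acyclic (f v) (map f vs)
    ( subst (2 ≤_) (sym (List.length-map f vs)) long
    , Unique.map⁺ inj unique
    , subst (λ ws → Linked (Adj K) (f v ∷ ws)) (List.map-++ f vs (v ∷ []))
            (Linked.map⁺ (Linked.map hom linked)) )

-- P is not required at the start.
Walk : {V : Set} → Graph V → Pred V 0ℓ → Rel V 0ℓ
Walk H P = Star (λ x y → Adj H x y × P y)

WalkConnected : {V : Set} → Graph V → Pred V 0ℓ → Set
WalkConnected H P = ∀ {x y} → P x → P y → Walk H P x y

-- A vertex of `induced H P` carries a proof of `P`, so even the trivial walk needs `irr` to
-- identify the proofs at its two ends.
walk⇒induced : ∀ {V : Set} {H : Graph V} {P : Pred V 0ℓ} → (∀ {x} (p q : P x) → p ≡ q) →
               ∀ {x y} → Walk H P x y → (p : P x) (q : P y) →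
               Star (Adj (induced H P)) (x , p) (y , q)
walk⇒induced irr ε p q with refl ← irr p q = ε
walk⇒induced {H = H} irr ((e , r) ◅ walk) p q = e ◅ walk⇒induced {H = H} irr walk r q

induced⇒walk : ∀ {V : Set} {H : Graph V} {P : Pred V 0ℓ} {x y : ∃ P} →
               Star (Adj (induced H P)) x y → Walk H P (proj₁ x) (proj₁ y)
induced⇒walk = Star.gmap proj₁ (λ {_} {y} e → e , proj₂ y)

-- Paths in graphs decomposed over complete trees

AllPairs-++⁻ : ∀ {A : Set} {R : Rel A 0ℓ} xs {ys} → AllPairs R (xs ++ ys) →
               AllPairs R xs × AllPairs R ys
AllPairs-++⁻ []       rs       = [] , rs
AllPairs-++⁻ (x ∷ xs) (r ∷ rs) with rs₁ , rs₂ ← AllPairs-++⁻ xs rs =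
  All.++⁻ˡ xs r ∷ rs₁ , rs₂

Linked-++⁻ : ∀ {A : Set} {R : Rel A 0ℓ} xs {ys} → Linked R (xs ++ ys) →
             Linked R xs × Linked R ys
Linked-++⁻ []           rs       = [] , rs
Linked-++⁻ (x ∷ [])     rs       = [-] , Linked.tail rs
Linked-++⁻ (x ∷ y ∷ xs) (r ∷ rs) with rs₁ , rs₂ ← Linked-++⁻ (y ∷ xs) rs =
  r ∷ rs₁ , rs₂

-- The c elements satisfying Q cut the list into c + 1 segments, of length less than M.
-- The accumulator ys is the initial part of the current segment.
segments-bound : ∀ {A : Set} {R : Pred (List A) 0ℓ} →
  (∀ xs {ys} → R (xs ++ ys) → R xs × R ys) →
  {Q : Pred A 0ℓ} (Q? : Decidable Q) (M : ℕ) →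
  (∀ xs → R xs → All (∁ Q) xs → length xs < M) →
  ∀ ys xs → R (ys ++ xs) → All (∁ Q) ys →
  length ys + length xs < suc (length (filter Q? xs)) * M
segments-bound {R = R} split Q? M bound ys [] r ¬Qys = begin
  suc (length ys + 0) ≡⟨ cong suc (+-identityʳ _) ⟩
  suc (length ys)     ≤⟨ bound ys (proj₁ (split ys r)) ¬Qys ⟩
  M                   ≡⟨ +-identityʳ M ⟨
  M + 0               ∎
  where open ≤-Reasoning
segments-bound {R = R} split Q? M bound ys (x ∷ xs) r ¬Qys with Q? x
... | yes _ = +-mono-≤ (bound ys (proj₁ (split ys r)) ¬Qys)
                (segments-bound split Q? M bound [] xs
                  (proj₂ (split (x ∷ []) (proj₂ (split ys r)))) [])
... | no ¬Qx = begin
  suc (length ys + suc (length xs))      ≡⟨ cong suc (+-assoc (length ys) 1 (length xs)) ⟨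
  suc (length ys + 1 + length xs)        ≡⟨ cong (λ l → suc (l + length xs)) (List.length-++ ys) ⟨
  suc (length (ys ∷ʳ x) + length xs)     ≤⟨ segments-bound split Q? M bound (ys ∷ʳ x) xs
                                              (subst R (sym (List.++-assoc ys (x ∷ []) xs)) r)
                                              (All.++⁺ ¬Qys (¬Qx ∷ [])) ⟩
  suc (length (filter Q? xs)) * M        ∎
  where open ≤-Reasoning

-- The only edge leaving the branch at `child i` ends in the root, which `P` excludes.
walk-below-child : ∀ {w h} {P : Pred (Node w (suc h)) 0ℓ} → ¬ P root → ∀ {i x y} →
  Walk (completeTree w (suc h)) P (child i x) y →
  ∃ λ z → y ≡ child i z × Walk (completeTree w h) (P ∘ child i) x z
walk-below-child ¬Pr ε = _ , refl , ε
walk-below-child ¬Pr ((fwd (there e) , p) ◅ walk)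
  with z , y≡ , walk′ ← walk-below-child ¬Pr walk = z , y≡ , (fwd e , p) ◅ walk′
walk-below-child ¬Pr ((bwd here , p) ◅ walk) = contradiction p ¬Pr
walk-below-child ¬Pr ((bwd (there e) , p) ◅ walk)
  with z , y≡ , walk′ ← walk-below-child ¬Pr walk = z , y≡ , (bwd e , p) ◅ walk′

module _ {A : Set} {w : ℕ} where

  Meets : ∀ {h} → (A → Pred (Node w h) 0ℓ) → Rel A 0ℓ
  Meets B u v = Satisfiable (B u ∩ B v)

  Spread : ∀ {h} → (A → Pred (Node w h) 0ℓ) → Pred A 0ℓ
  Spread {h} B v = Satisfiable (B v) × WalkConnected (completeTree w h) (B v)

  DecomposedPath : ∀ {h} → (A → Pred (Node w h) 0ℓ) → Pred (List A) 0ℓ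
  DecomposedPath B vs = Unique vs × Linked (Meets B) vs × All (Spread B) vs

  path-++⁻ : ∀ {h} {B : A → Pred (Node w h) 0ℓ} us {vs} → DecomposedPath B (us ++ vs) →
             DecomposedPath B us × DecomposedPath B vs
  path-++⁻ us (unique , linked , spread)
    with u₁ , u₂ ← AllPairs-++⁻ us unique
       | l₁ , l₂ ← Linked-++⁻ us linked
       | s₁ , s₂ ← All.++⁻ us spread = (u₁ , l₁ , s₁) , (u₂ , l₂ , s₂)

  -- A connected set avoiding the root stays in one branch. Consecutive sets meet, so the branch of
  -- the first set passes along the whole path.
  path-below-child : ∀ {h} {B : A → Pred (Node w (suc h)) 0ℓ} {i v vs} →
    All (λ u → ¬ B u root) (v ∷ vs) → Linked (Meets B) (v ∷ vs) → All (Spread B) (v ∷ vs) →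
    Satisfiable (B v ∘ child i) →
    Linked (Meets (λ u → B u ∘ child i)) (v ∷ vs) × All (Spread (λ u → B u ∘ child i)) (v ∷ vs)
  path-below-child {h} {B} {i} {v} (¬r ∷ ¬rs) linked ((_ , conn) ∷ spread) (z , Bvz) =
    rest ¬rs linked spread
    where
    below : ∀ {y} → B v y → ∃ λ z → y ≡ child i z
    below Bvy with z , y≡ , _ ← walk-below-child ¬r (conn Bvz Bvy) = z , y≡

    conn′ : WalkConnected (completeTree w h) (B v ∘ child i)
    conn′ p q with _ , refl , walk ← walk-below-child ¬r (conn p q) = walk

    rest : ∀ {vs} → All (λ u → ¬ B u root) vs → Linked (Meets B) (v ∷ vs) →
           All (Spread B) vs →
           Linked (Meets (λ u → B u ∘ child i)) (v ∷ vs) ×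
           All (Spread (λ u → B u ∘ child i)) (v ∷ vs)
    rest [] _ [] = [-] , ((z , Bvz) , conn′) ∷ []
    rest ¬rs@(_ ∷ _) ((y , Bvy , Buy) ∷ linked) spread@(_ ∷ _)
      with z′ , refl ← below Bvy
      with linked′ , spread′ ← path-below-child ¬rs linked spread (z′ , Buy) =
      (z′ , Bvy , Buy) ∷ linked′ , ((z , Bvz) , conn′) ∷ spread′

  -- Induction on `h`. At most `K` vertices of the path lie in the root bag, and they cut it into at
  -- most `K + 1` segments. Each segment avoids the root bag, so it is decomposed over a single
  -- branch, of smaller height.
  path-length : ∀ K h (B : A → Pred (Node w h) 0ℓ) → (∀ v x → Dec (B v x)) →
    (∀ x vs → Unique vs → All (λ v → B v x) vs → length vs ≤ K) →
    ∀ vs → DecomposedPath B vs → length vs < suc K ^ suc h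
  path-length K h B B? bounded vs path@(unique , _) = begin-strict
    length vs
      <⟨ segments-bound path-++⁻ Q? (suc K ^ h) (between h B B? bounded) [] vs path [] ⟩
    suc (length (filter Q? vs)) * suc K ^ h
      ≤⟨ *-monoˡ-≤ (suc K ^ h) (s≤s (bounded root (filter Q? vs)
           (Unique.filter⁺ Q? unique) (All.all-filter Q? vs))) ⟩
    suc K ^ suc h ∎
    where
    open ≤-Reasoning
    Q? = λ v → B? v root

    between : ∀ h (B : A → Pred (Node w h) 0ℓ) → (∀ v x → Dec (B v x)) →
      (∀ x vs → Unique vs → All (λ v → B v x) vs → length vs ≤ K) →
      ∀ vs → DecomposedPath B vs → All (λ v → ¬ B v root) vs → length vs < suc K ^ h
    between h B B? bounded [] path ¬rs = m^n>0 (suc K) h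
    -- At height 0 the bound `suc K ^ 0` is 1: a nonempty segment would need the root bag, the only
    -- one there is.
    between zero B B? bounded (v ∷ vs) (_ , _ , ((root , b) , _) ∷ _) (¬r ∷ _) =
      contradiction b ¬r
    between (suc h) B B? bounded (v ∷ vs) (_ , _ , ((root , b) , _) ∷ _) (¬r ∷ _) =
      contradiction b ¬r
    between (suc h) B B? bounded (v ∷ vs)
      (unique , linked , spread@(((child i z , b) , _) ∷ _)) ¬rs =
      path-length K h (λ u → B u ∘ child i) (λ u → B? u ∘ child i) (bounded ∘ child i) (v ∷ vs)
        (unique , path-below-child ¬rs linked spread (z , b))

-- The construction of G̃

child-injectiveʳ : ∀ {w h i} → Injective _≡_ _≡_ (child {w} {h} i)
child-injectiveʳ refl = refl

child-injectiveˡ : ∀ {w h} {x : Node w h} → Injective _≡_ _≡_ (λ i → child i x)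
child-injectiveˡ refl = refl

-- The injective families include those of the children of the nonleaves.
descending-path : ∀ {w} h {Good : Pred (Node w h) 0ℓ} →
  ((c : Fin w → Node w h) → Injective _≡_ _≡_ c → ∃ (Good ∘ c)) →
  ∃ λ xs → length xs ≡ h × Unique (root ∷ xs) × Linked ParentOf (root ∷ xs) × All Good xs
descending-path zero good = [] , refl , [] ∷ [] , [-] , []
descending-path (suc h) good
  with i , g ← good (λ i → child i root) child-injectiveˡ
  with xs , len , unique , linked , goods ←
         descending-path h (λ c inj → good (child i ∘ c) (inj ∘ child-injectiveʳ)) =
  map (child i) (root ∷ xs)
  , cong suc (trans (List.length-map (child i) xs) len)
  , All.map⁺ (All.universal (λ _ ()) (root ∷ xs)) ∷ Unique.map⁺ child-injectiveʳ unique
  , here ∷ Linked.map⁺ (Linked.map there linked)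
  , g ∷ All.map⁺ goods

size-Σ-finite : ∀ {n} (F : Fin n → Set) (fin : ∀ i → Finite (F i)) →
  Finite.size (Σ-finite F fin) ≡ sum +-0-commutativeMonoid (λ i → Finite.size (fin i))
size-Σ-finite {zero}  F fin = refl
size-Σ-finite {suc n} F fin =
  cong (Finite.size (fin zero) +_) (size-Σ-finite (F ∘ suc) (fin ∘ suc))

-- Listing the nodes of the later trees turns the sum in the definition of w_j into a length, so
-- that w_j can be compared with the capacity of that many bags.
later-nodes : ∀ k n {m} (h : Fin m → ℕ) (j : Fin m) →
  Σ[ L ∈ List (Σ (Fin m) λ i → Node (arities k n h i) (h i)) ]
    (∀ {i} x → toℕ j < toℕ i → (i , x) ∈ᴸ L) ×
    arities k n h j ≡ (k + 1) * (n + length L) + 1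
later-nodes k n {suc m} h zero =
  map shift (elements N)
  , (λ { {suc i} x _ → ∈-map⁺ shift (∈-elements (i , x)) })
  , cong (λ s → (k + 1) * (n + s) + 1)
      (sym (trans (List.length-map shift (elements N))
                  (trans (List.length-tabulate _) (size-Σ-finite F fin))))
  where
  F : Fin m → Set
  F i = Node (arities k n (h ∘ suc) i) (h (suc i))

  fin : ∀ i → Finite (F i)
  fin _ = finite-Node _ _

  N = Σ (Fin m) F

  instance
    N-finite : Finite N
    N-finite = Σ-finite F fin

  shift : N → Σ (Fin (suc m)) λ i → Node (arities k n h i) (h i)
  shift (i , x) = suc i , x
later-nodes k n {suc m} h (suc j) with L , later , eq ← later-nodes k n (h ∘ suc) j =
  map shift L
  , (λ { {suc i} x (s≤s j<i) → ∈-map⁺ shift (later x j<i) })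
  , trans eq (cong (λ l → (k + 1) * (n + l) + 1) (sym (List.length-map shift L)))
  where
  shift : (Σ (Fin m) λ i → Node (arities k n (h ∘ suc) i) (h (suc i))) →
          Σ (Fin (suc m)) λ i → Node (arities k n h i) (h i)
  shift (i , x) = suc i , x

-- Growth of the heights

heights>0 : ∀ k m → 0 < heights k m
heights>0 k zero    = z<s
heights>0 k (suc m) = ≤-trans (s≤s z≤n) (m≤n+m 1 _)

-- The left side is the bound of `path-length` for bags of size at most `k + 1`. Heights are
-- positive, so the factor 2 in the exponent of the recursion absorbs the successor.
path-length<heights : ∀ k m → suc (suc k) ^ suc (heights k m) < heights k (suc m)
path-length<heights k m = begin-strict
  suc (suc k) ^ suc (heights k m) ≤⟨ ^-monoʳ-≤ (suc (suc k)) (begin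
      suc (heights k m)           ≤⟨ +-monoˡ-≤ (heights k m) (heights>0 k m) ⟩
      heights k m + heights k m   ≡⟨ cong (heights k m +_) (+-identityʳ _) ⟨
      2 * heights k m             ∎) ⟩
  suc (suc k) ^ (2 * heights k m) ≡⟨ cong (_^ (2 * heights k m)) (+-comm 2 k) ⟩
  (k + 2) ^ (2 * heights k m)     <⟨ m<m+n _ z<s ⟩
  heights k (suc m)               ∎
  where open ≤-Reasoning

n<m^n : ∀ m n → n < suc (suc m) ^ n
n<m^n m zero    = z<s
n<m^n m (suc n) = +-mono-≤ (m^n>0 (suc (suc m)) n) (≤-trans (n<m^n m n) (m≤m+n _ _))

heights-mono-≤ : ∀ k {l m} → l ≤ m → heights k l ≤ heights k m
heights-mono-≤ k l≤m = go (≤⇒≤′ l≤m)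
  where
  step : ∀ m → heights k m ≤ heights k (suc m)
  step m = <⇒≤ (<-trans (<-trans (n<1+n (heights k m)) (n<m^n k (suc (heights k m))))
                        (path-length<heights k m))

  go : ∀ {l m} → l ≤′ m → heights k l ≤ heights k m
  go (≤′-reflexive refl) = ≤-refl
  go (≤′-step {m} l≤m)   = ≤-trans (go l≤m) (step m)

-- Width and bag sizes

bag-size≤1+width : ∀ {X V : Set} {{_ : Finite X}} {{_ : Finite V}} {H : Graph V} {T : Graph X}
                   (D : TreeDecomposition H T) x → Sub.∣ bag D x ∣ ≤ suc (width D)
bag-size≤1+width {X} D x =
  ≤-trans (All.lookup (Extrema.xs≤max 0 sizes) (∈-map⁺ _ (∈-elements x)))
          -- `m ≤ 1 + (m ∸ 1)` holds also for `m = 0`, so the truncated subtraction does no harm.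
          (m≤n+m∸n (Extrema.max 0 sizes) 1)
  where sizes = map (λ x → Sub.∣ bag D x ∣) (elements X)

width≤ : ∀ {X V : Set} {{_ : Finite X}} {{_ : Finite V}} {H : Graph V} {T : Graph X}
         (D : TreeDecomposition H T) {K} → (∀ x → Sub.∣ bag D x ∣ ≤ suc K) → width D ≤ K
width≤ {X} D small =
  ∸-monoˡ-≤ 1 (Extrema.max≤v⁺ z≤n (All.map⁺ (All.universal small (elements X))))

-- The position of the subtrees T_v among the trees S_j

module _ {k : ℕ} {V : Set} {{finite-V : Finite V}} (G : Graph V) {n : ℕ} (a : Fin n ↔ V)
         (T : Graph (V~ k n)) (D : TreeDecomposition (G~ k G a) T)
         (T⊆G~ : Adj T ⇒ Adj (G~ k G a)) (small : ∀ x → Sub.∣ bag D x ∣ ≤ suc k) where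

  private
    module D = TreeDecomposition D
    open Inverse a using (to; from)

    from∘to : ∀ i → from (to i) ≡ i
    from∘to = Inverse.strictlyInverseʳ a

    to∘from : ∀ v → to (from v) ≡ v
    to∘from = Inverse.strictlyInverseˡ a

    B : V~ k n → V~ k n → Set
    B = BagsAt (bag D)

    B? : ∀ v x → Dec (B v x)
    B? v x = index v Sub.∈? bag D x

  B-connected : ∀ v → WalkConnected T (B v)
  B-connected v p q = induced⇒walk {H = T} (proj₂ (proj₁ (D.subtrees v)) (_ , p) (_ , q))

  -- Edges of `T` are edges of G̃, and these leave a part only from its root. So a walk inside T_v
  -- from part `i` to another part visits the root of part `i`.
  through-root : ∀ {v i j x y} → B v (i , x) → B v (j , y) → i ≢ j → B v (i , root)
  through-root {v} p q i≢j = go (B-connected v p q) p i≢j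
    where
    go : ∀ {i j x y} → Walk T (B v) (i , x) (j , y) → B v (i , x) → i ≢ j → B v (i , root)
    go ε p i≢j = contradiction refl i≢j
    go ((e , q) ◅ walk) p i≢j with T⊆G~ e
    ... | inG _ = p
    ... | inS _ = go walk q i≢j

  module _ (j : Fin n) where

    private
      L = proj₁ (later-nodes k n (height k) j)

      -- All roots, and all nodes of the trees of index above `j`. The roots of the later trees
      -- occur twice, matching the count in the definition of w_j.
      avoided : List (V~ k n)
      avoided = map (λ i → i , root) (allFin n) ++ map (λ { (i , x) → i , x }) L

      length-avoided : length avoided ≡ n + length L
      length-avoided = trans (List.length-++ (map (λ i → i , root) (allFin n)))
        (cong₂ _+_ (trans (List.length-map _ (allFin n)) (List.length-tabulate {n = n} id))
                   (List.length-map _ L))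

      Held : Pred (Node (arity k j) (height k j)) 0ℓ
      Held y = index (j , y) Sub.∈ ⋃ (map (bag D) avoided)

      arity≰ : ¬ arity k j ≤ length (map (bag D) avoided) * suc k
      arity≰ a≤ = <-irrefl refl (begin-strict
        length (map (bag D) avoided) * suc k ≡⟨ cong (_* suc k) (List.length-map (bag D) avoided) ⟩
        length avoided * suc k       ≡⟨ cong₂ _*_ length-avoided (+-comm 1 k) ⟩
        (n + length L) * (k + 1)     ≡⟨ *-comm (n + length L) (k + 1) ⟩
        (k + 1) * (n + length L)     <⟨ m<m+n _ z<s ⟩
        (k + 1) * (n + length L) + 1 ≡⟨ proj₂ (proj₂ (later-nodes k n (height k) j)) ⟨
        arity k j                    ≤⟨ a≤ ⟩
        length (map (bag D) avoided) * suc k ∎)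
        where open ≤-Reasoning

      index-node-injective : ∀ {x y} → index {V~ k n} (j , x) ≡ index {V~ k n} (j , y) → x ≡ y
      index-node-injective {x} {y} eq
        with refl ← index-injective {V~ k n} {x = j , x} {j , y} eq = refl

      -- Pigeonhole: the avoided bags hold at most `(k + 1) * (n + length L)` vertices, one fewer
      -- than w_j, while injectivity makes the w_j members of the family distinct.
      unheld-member : (c : Fin (arity k j) → Node (arity k j) (height k j)) →
                    Injective _≡_ _≡_ c → ∃ λ i → ¬ Held (c i)
      unheld-member c inj = Fin.¬∀⟶∃¬ _ (Held ∘ c) (λ i → index (j , c i) Sub.∈? _) λ held →
        arity≰ (≤-trans
          (≤-trans (≤-reflexive (sym (List.length-tabulate (λ i → index (j , c i)))))
                   (unique⇒length≤∣p∣ (Unique.tabulate⁺ (inj ∘ index-node-injective))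
                                      (All.tabulate⁺ held)))
          (∣⋃ps∣≤length*K (All.map⁺ (All.universal small avoided))))

      avoids-root : ∀ {y} → ¬ Held y → ∀ i → ¬ B (j , y) (i , root)
      avoids-root ¬held i b =
        ¬held (p⊆⋃ps (∈-map⁺ (bag D) (∈-++⁺ˡ (∈-map⁺ (λ i → i , root) (∈-allFin i)))) b)

      avoids-later : ∀ {y} → ¬ Held y → ∀ {i x} → B (j , y) (i , x) → toℕ i ≤ toℕ j
      avoids-later ¬held {i} {x} b = ≮⇒≥ λ j<i →
        ¬held (p⊆⋃ps (∈-map⁺ (bag D) (∈-++⁺ʳ (map (λ i → i , root) (allFin n))
          (∈-map⁺ (λ { (i , x) → i , x }) (proj₁ (proj₂ (later-nodes k n (height k) j)) x j<i)))) b)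

      -- A subtree meeting two parts would contain a root, and the bags at all roots are among the
      -- avoided ones.
      same-part : ∀ {y} → ¬ Held y → ∀ {i l x z} → B (j , y) (i , x) → B (j , y) (l , z) → l ≡ i
      same-part ¬held {i} {l} p q with l Fin.≟ i
      ... | yes eq = eq
      ... | no l≢i = contradiction (through-root q p l≢i) (avoids-root ¬held l)

      walk-in-part : ∀ {y} → ¬ Held y → ∀ {i} →
                     WalkConnected (S k i) (λ x → B (j , y) (i , x))
      walk-in-part {y} ¬held p q = go (B-connected (j , y) p q)
        where
        go : ∀ {i x z} → Walk T (B (j , y)) (i , x) (i , z) →
             Walk (S k i) (λ x → B (j , y) (i , x)) x z
        go ε = ε
        go ((e , b) ◅ walk) with T⊆G~ e
        -- An edge of G ends in a root, which the subtree of an unheld vertex avoids; so the walk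
        -- uses edges of S_i only.
        ... | inG _  = contradiction b (avoids-root ¬held _)
        ... | inS e′ = (e′ , b) ◅ go walk

      -- Adjacent vertices share a bag, and `same-part` places that bag in the part already reached;
      -- the part `i` is thus inherited along the path.
      path-in-part : ∀ {i v vs} → All (∁ Held) (v ∷ vs) → Linked ParentOf (v ∷ vs) →
        Satisfiable (λ x → B (j , v) (i , x)) →
        Linked (Meets (λ y x → B (j , y) (i , x))) (v ∷ vs) ×
        All (Spread (λ y x → B (j , y) (i , x))) (v ∷ vs)
      path-in-part (¬held ∷ []) [-] sat = [-] , (sat , walk-in-part ¬held) ∷ []
      path-in-part (¬held ∷ ¬helds) (e ∷ linked) sat@(_ , b)
        with (l , x) , p , q ← D.edges (inS (fwd e))
        with refl ← same-part ¬held b p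
        with linked′ , spread′ ← path-in-part ¬helds linked (x , q) =
        (x , p , q) ∷ linked′ , (sat , walk-in-part ¬held) ∷ spread′

      small-bags : ∀ {i} (x : Node (arity k i) (height k i))
                   (vs : List (Node (arity k j) (height k j))) →
                   Unique vs → All (λ y → B (j , y) (i , x)) vs → length vs ≤ suc k
      small-bags {i} x vs unique vs⊆bag = begin
        length vs                              ≡⟨ List.length-map (λ y → index (j , y)) vs ⟨
        length (map (λ y → index (j , y)) vs)  ≤⟨ unique⇒length≤∣p∣ (Unique.map⁺ index-node-injective unique)
                                                                     (All.map⁺ vs⊆bag) ⟩
        Sub.∣ bag D (i , x) ∣                  ≤⟨ small (i , x) ⟩
        suc k                                  ∎
        where open ≤-Reasoning

    -- The subtrees along a descending path of unheld vertices share one part `i`. Since h_j is too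
    -- large for a path decomposed over a smaller S_i, that part is `j`, and the subtree of the root
    -- meets it next to that of the first path vertex.
    meets-own-part : ∃ λ y → B (j , root) (j , y)
    meets-own-part with descending-path (height k j) unheld-member
    ... | [] , len , _ = contradiction (subst (0 <_) (sym len) (heights>0 k (toℕ j))) λ ()
    ... | v ∷ vs , len , _ ∷ unique , e ∷ linked , goods@(¬held ∷ _)
      with ((i , x) , b) , _ ← proj₁ (D.subtrees (j , v))
      with i Fin.≟ j
    -- The root is adjacent to `v`, so they share a bag, which lies in part `j` because all bags of
    -- `v` do.
    ... | yes refl with (l , z) , p , q ← D.edges (inS (fwd e))
                   with refl ← same-part ¬held b q = z , p
    -- Unheld vertices avoid later trees, so `i` is below `j`, and `height k j` is at least
    -- `heights k (suc (toℕ i))`, which exceeds the length bound over S_i.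
    ... | no i≢j = contradiction (begin-strict
      height k j                     ≡⟨ len ⟨
      length (v ∷ vs)                <⟨ path-length (suc k) (height k i) (λ y x → B (j , y) (i , x))
                                         (λ y x → B? (j , y) (i , x)) small-bags (v ∷ vs)
                                         (unique , path-in-part goods linked (x , b)) ⟩
      suc (suc k) ^ suc (height k i) <⟨ path-length<heights k (toℕ i) ⟩
      heights k (suc (toℕ i))        ≤⟨ heights-mono-≤ k (≤∧≢⇒< (avoids-later ¬held b)
                                                           (i≢j ∘ Fin.toℕ-injective)) ⟩
      height k j                     ∎) (<-irrefl refl)
      where open ≤-Reasoning

  -- The spanning tree of G and its decomposition

  a⁻¹ : V → V~ k n
  a⁻¹ v = from v , root

  a⁻¹-injective : Injective _≡_ _≡_ a⁻¹
  a⁻¹-injective {u} {v} eq = trans (sym (to∘from u)) (trans (cong (to ∘ V~.part) eq) (to∘from v))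

  T′ : Graph V
  T′ = record
    { Adj    = Adj T on a⁻¹
    ; adj?   = λ u v → Graph.adj? T (a⁻¹ u) (a⁻¹ v)
    ; sym    = Graph.sym T
    ; irrefl = λ u≡v → Graph.irrefl T (cong a⁻¹ u≡v)
    }

  -- Contract every part to its root: steps inside a part disappear, and steps between parts already
  -- join roots. Each new vertex of the projected walk was therefore visited by the original one, so
  -- `P` survives.
  project-walk : ∀ {P x y} → Walk T P x y → ∀ {u v} → from u ≡ V~.part x → from v ≡ V~.part y →
                 Walk T′ (P ∘ a⁻¹) u v
  project-walk ε {u} {v} p q
    with refl ← a⁻¹-injective {u} {v} (cong (_, root) (trans p (sym q))) = ε
  project-walk {P} ((e , r) ◅ walk) {u} p q with T⊆G~ e
  ... | inG {i} {j} _ =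
    ( subst₂ (Adj T) (cong (_, root) (sym p)) (cong (_, root) (sym (from∘to j))) e
    , subst P (cong (_, root) (sym (from∘to j))) r )
    ◅ project-walk walk (from∘to j) q
  ... | inS _ = project-walk walk p q

  private
    C : V → V → Set
    C v u = B (a⁻¹ v) (a⁻¹ u)

    C? : ∀ v u → Dec (C v u)
    C? v u = B? (a⁻¹ v) (a⁻¹ u)

    module V = Inverse (Finite.enumeration finite-V)

    vertex-injective : Injective _≡_ _≡_ V.from
    vertex-injective {i} {j} eq =
      trans (sym (V.strictlyInverseˡ i)) (trans (cong V.to eq) (V.strictlyInverseˡ j))

    -- The set B_u ∩ V(G), re-encoded as a subset of `V`.
    trace : V → Subset V
    trace u = Vec.tabulate (λ i → does (C? (V.from i) u))

    ∈-trace⁻ : ∀ {i u} → i Sub.∈ trace u → C (V.from i) u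
    ∈-trace⁻ {i} {u} e with C? (V.from i) u | trans (sym (lookup∘tabulate _ i)) ([]=⇒lookup e)
    ... | yes c | _ = c

    ∈-trace⁺ : ∀ {v u} → C v u → v ∈ trace u
    ∈-trace⁺ {v} {u} c = lookup⇒[]= (V.to v) (trace u)
      (trans (lookup∘tabulate _ (V.to v))
             (dec-true (C? _ u) (subst (λ v → C v u) (sym (V.strictlyInverseʳ v)) c)))

    bag′ : V → Subset V
    bag′ u = ⁅ index u ⁆ ∪ trace u

    ∈-bag′⁺ : ∀ {v u} → C v u → v ∈ bag′ u
    ∈-bag′⁺ c = Sub.x∈p∪q⁺ (inj₂ (∈-trace⁺ c))

    self∈bag′ : ∀ v → v ∈ bag′ v
    self∈bag′ v = Sub.x∈p∪q⁺ (inj₁ (Sub.x∈⁅x⁆ (index v)))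

    ∈-bag′⁻ : ∀ {v u} → v ∈ bag′ u → v ≡ u ⊎ C v u
    ∈-bag′⁻ {v} {u} e with Sub.x∈p∪q⁻ ⁅ index u ⁆ (trace u) e
    ... | inj₁ v∈⁅u⁆ = inj₁ (index-injective (Sub.x∈⁅y⁆⇒x≡y (index u) v∈⁅u⁆))
    ... | inj₂ v∈t   = inj₂ (subst (λ v → C v u) (V.strictlyInverseʳ v) (∈-trace⁻ v∈t))

    -- The trace embeds into the bag of `T` at the root for `u`; adding `u` itself costs the one
    -- extra unit of width.
    ∣bag′∣≤ : ∀ u → Sub.∣ bag′ u ∣ ≤ suc (suc k)
    ∣bag′∣≤ u = ≤-trans (∣p∪q∣≤∣p∣+∣q∣ ⁅ index u ⁆ (trace u))
      (+-mono-≤ (≤-reflexive (Sub.∣⁅x⁆∣≡1 (index u)))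
        (≤-trans (injective⇒∣p∣≤∣q∣ (λ i → index (a⁻¹ (V.from i)))
                   (vertex-injective ∘ a⁻¹-injective ∘ index-injective)
                   (trace u) (bag D (a⁻¹ u)) ∈-trace⁻)
                 (small (a⁻¹ u))))

    -- By `meets-own-part` the subtree of `a⁻¹ v` meets the part of `v`; if it also meets another
    -- part, it passes through the root `a⁻¹ v`.
    C-far⇒self : ∀ {v u} → C v u → C v v
    C-far⇒self {v} {u} c with from v Fin.≟ from u
    ... | yes eq = subst (λ i → B (a⁻¹ v) (i , root)) (sym eq) c
    ... | no neq = through-root (proj₂ (meets-own-part (from v))) c neq

    ∉self⇒only-self : ∀ {v u} → ¬ C v v → v ∈ bag′ u → v ≡ u
    ∉self⇒only-self ¬c p with ∈-bag′⁻ p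
    ... | inj₁ eq = eq
    ... | inj₂ c  = contradiction (C-far⇒self c) ¬c

    -- If `C v v`, adding `v` to its own bag changes nothing and walks in T_v project. Otherwise `v`
    -- lies in no new bag but its own, and the walk is trivial.
    bag′-walk : ∀ {v x y} → v ∈ bag′ x → v ∈ bag′ y → Walk T′ (λ u → v ∈ bag′ u) x y
    bag′-walk {v} p q with C? v v
    ... | yes c = Star.map (λ { (e , c) → e , ∈-bag′⁺ c })
                    (project-walk (B-connected (a⁻¹ v) (in-C p) (in-C q)) refl refl)
      where
      in-C : ∀ {u} → v ∈ bag′ u → C v u
      in-C p with ∈-bag′⁻ p
      ... | inj₁ refl = c
      ... | inj₂ c    = c
    ... | no ¬c with refl ← ∉self⇒only-self ¬c p | refl ← ∉self⇒only-self ¬c q = ε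

    -- Walks of `T` project to `T′`, and a cycle of `T′` would be a cycle of `T` through roots.
    tree′ : IsTree T′
    tree′ =
      ( to (V~.part (proj₁ (proj₁ D.tree)))
      , λ u v → Star.map proj₁
          (project-walk {λ _ → ⊤} (Star.map (_, tt) (proj₂ (proj₁ D.tree) (a⁻¹ u) (a⁻¹ v)))
                        refl refl) )
      , acyclic-pullback T′ T a⁻¹ a⁻¹-injective id (proj₂ D.tree)

    subtree′ : ∀ v → IsTree (subtree T′ bag′ v)
    subtree′ v =
      ( (v , self∈bag′ v)
      , λ { (x , p) (y , q) → walk⇒induced {H = T′} []=-irrelevant (bag′-walk p q) p q } )
      , acyclic-pullback (subtree T′ bag′ v) T′ proj₁ proj₁-injective id (proj₂ tree′)
      where
      proj₁-injective : Injective _≡_ _≡_ (proj₁ {B = BagsAt bag′ v})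
      proj₁-injective {x , p} {_ , q} refl = cong (x ,_) ([]=-irrelevant p q)

    -- Some bag of `T`, in a part `l`, contains both ends. An end whose own part is not `l` has a
    -- subtree meeting two parts, hence containing the root of `l`; an end whose own part is `l` is
    -- in the new bag there by construction.
    edge′ : ∀ {u v} → Adj G u v → Satisfiable (BagsAt bag′ u ∩ BagsAt bag′ v)
    edge′ {u} {v} e
      with (l , x) , p , q ← D.edges (inG (subst₂ (Adj G) (sym (to∘from u)) (sym (to∘from v)) e))
      with l Fin.≟ from u | l Fin.≟ from v
    ... | yes refl | yes eq = contradiction
      (trans (sym (to∘from u)) (trans (cong to eq) (to∘from v))) (λ u≡v → Graph.irrefl G u≡v e)
    ... | yes refl | no l≢v =
      u , self∈bag′ u , ∈-bag′⁺ (through-root q (proj₂ (meets-own-part (from v))) l≢v)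
    ... | no l≢u | yes refl =
      v , ∈-bag′⁺ (through-root p (proj₂ (meets-own-part (from u))) l≢u) , self∈bag′ v
    ... | no l≢u | no l≢v = to l , at-l p l≢u , at-l q l≢v
      where
      at-l : ∀ {w} → B (a⁻¹ w) (l , x) → l ≢ from w → w ∈ bag′ (to l)
      at-l {w} r l≢w = ∈-bag′⁺ (subst (λ i → B (a⁻¹ w) (i , root)) (sym (from∘to l))
        (through-root r (proj₂ (meets-own-part (from w))) l≢w))

  T′⊆G : Adj T′ ⇒ Adj G
  T′⊆G {u} {v} e with from u | from v | to∘from u | to∘from v | T⊆G~ e
  ... | i | j | eq | eq′ | f = root-edge f eq eq′
    where
    -- The indices are general so that the edge can be matched on. An edge inside one S_j cannot
    -- join two roots, so only edges of G remain.
    root-edge : ∀ {i j u v} → Adj~ k G a (i , root) (j , root) → to i ≡ u → to j ≡ v → Adj G u v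
    root-edge (inG e) refl refl = e
    root-edge (inS (fwd ())) _ _
    root-edge (inS (bwd ())) _ _

  D′ : TreeDecomposition G T′
  D′ = record { bag = bag′ ; tree = tree′ ; subtrees = subtree′ ; edges = edge′ }

  spanning-decomposition : Σ[ T′ ∈ Graph V ] Σ[ D′ ∈ TreeDecomposition G T′ ]
    (IsSpanningTree T′ G × width D′ ≤ k + 1 × ((v : V) → BagsAt (bag D′) v v))
  spanning-decomposition = T′ , D′ , (tree′ , T′⊆G)
    , width≤ D′ (λ u → subst (λ m → Sub.∣ bag′ u ∣ ≤ suc m) (+-comm 1 k) (∣bag′∣≤ u))
    , self∈bag′

lemma3p3 : (k : ℕ) .{{_ : NonZero k}} {V : Set} {{_ : Finite V}} (G : Graph V) →
    Connected G →
    {n : ℕ} (a : Fin n ↔ V) →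
    Σ[ T ∈ Graph (V~ k n) ] Σ[ D ∈ TreeDecomposition (G~ k G a) T ]
    (IsSpanningTree T (G~ k G a) × width D ≤ k) →
    Σ[ T′ ∈ Graph V ] Σ[ D′ ∈ TreeDecomposition G T′ ]
    (IsSpanningTree T′ G × width D′ ≤ k + 1 × ((v : V) → BagsAt (bag D′) v v))
lemma3p3 k G _ a (T , D , (_ , T⊆G~) , width≤k) =
  spanning-decomposition G a T D T⊆G~ (λ x → ≤-trans (bag-size≤1+width D x) (s≤s width≤k))
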